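{- $2$-coherence is not a necessary condition for a wild left adjoint to preserve colimits. Concretely, let $\mathcal E$, $\Lambda:\mathcal E\to\mathcal E$ and the evident adjunction $\Lambda\dashv\Lambda$ be as in the context. Then $\Lambda$ is not $2$-coherent, but $\Lambda$ preserves colimits: for every graph $\Gamma$, every $\Gamma$-shaped diagram $F$ in $\mathcal E$ and every colimiting cocone $\mathcal K$ under $F$, the cocone $\Lambda(\mathcal K)$ under $\Lambda(F)$ is colimiting.
   Context: Everything is inside Book HoTT; $p\cdot q$ is path concatenation, $\mathsf{ap}_f$ the action of $f$ on paths. Wild category: a type of objects, a family $\mathsf{hom}$ of types (not assumed sets), identities, composition $\circ$, unit laws (paths), and $\mathsf{assoc}(f,g,h):(f\circ g)\circ h=f\circ(g\circ h)$; no further coherence. Wild functor $F$: functions on objects and morphisms with paths $F_\circ(g,f):F(g)\circ F(f)=F(g\circ f)$ and $F_{\mathsf{id}}(X):\mathsf{id}_{F(X)}=F(\mathsf{id}_X)$. Wild adjunction $L\dashv R$ (with $L:\mathcal C\to\mathcal D$): equivalences $\psi:\mathsf{hom}_{\mathcal D}(L(A),X)\simeq\mathsf{hom}_{\mathcal C}(A,R(X))$ with paths $\mathsf{nat}_{cod}(g,h):R(g)\circ\psi(h)=\psi(g\circ h)$ and $\mathsf{nat}_{dom}(f,h):\psi(h)\circ f=\psi(h\circ L(f))$. $L$ is $2$-coherent if for all $h_1:\mathsf{hom}_{\mathcal D}(L(X),Y)$, $h_2:\mathsf{hom}_{\mathcal C}(Z,X)$, $h_3:\mathsf{hom}_{\mathcal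 C}(W,Z)$: $$\mathsf{assoc}(\psi(h_1),h_2,h_3)\cdot\mathsf{nat}_{dom}(h_2\circ h_3,h_1)\cdot\mathsf{ap}_\psi(\mathsf{ap}_{h_1\circ- }(L_\circ(h_2,h_3)))^{ -1}$$ $$=\ \mathsf{ap}_{ -\circ h_3}(\mathsf{nat}_{dom}(h_2,h_1))\cdot\mathsf{nat}_{dom}(h_3,h_1\circ L(h_2))\cdot\mathsf{ap}_\psi(\mathsf{assoc}(h_1,L(h_2),L(h_3))).$$ Graph: a type $\Gamma_0$ and types $\Gamma_1(i,j)$. Diagram $F$: objects $F_i$ and morphisms $F_{i,j,g}:\mathsf{hom}(F_i,F_j)$ for $g:\Gamma_1(i,j)$. Cocone $(C,r,K)$ under $F$: an object $C$, $r_i:\mathsf{hom}(F_i,C)$, paths $K_{i,j,g}:r_j\circ F_{i,j,g}=r_i$. It is colimiting if for every object $X$ the map $\mathsf{hom}(C,X)\to\sum_{s:\prod_i\mathsf{hom}(F_i,X)}\prod_{i,j,g}s_j\circ F_{i,j,g}=s_i$, $f\mapsto(\lambda i.f\circ r_i,\ \mathsf{assoc}(f,r_j,F_{i,j,g})\cdot\mathsf{ap}_{f\circ- }(K_{i,j,g}))$ is an equivalence. For a functor $L$, $L(F)$ is the image diagram and $L(C,r,K):=(L(C),L(r_i),L_\circ(r_j,F_{i,j,g})\cdot\mathsf{ap}_L(K_{i,j,g}))$. The wild category $\mathcal E$: $\mathsf{Ob}(\mathcal E):=\mathbf 1$, $\mathsf{hom}(\ast,\ast):=S^1$, where $S^1$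 is the circle with $\mathsf{base}$ and $\mathsf{loop}:\mathsf{base}=\mathsf{base}$. Fix a pointed equivalence of $(S^1,\mathsf{base})$ with the loop space of the Eilenberg–MacLane space $K(\mathbb Z,2)$; let $\bullet$ be the operation on $S^1$ obtained from path concatenation. Composition is $g\circ f:=f\bullet g$, the identity morphism is $\mathsf{base}$, and the unit and associativity laws come from those of path concatenation. For $\ell:S^1$ the map $x\mapsto x\bullet\ell$ is a pointed equivalence $(S^1,\mathsf{base})\to(S^1,\ell)$ (pointed by the unit law), and $\mathsf L_\ell:\ell=\ell$ denotes the image of $\mathsf{loop}$ under the induced map on loop spaces. The functor $\Lambda:\mathcal E\to\mathcal E$ is the identity on objects and morphisms (with trivial identity law) and $\Lambda_\circ(g,f):=\mathsf L_{g\circ f}$. The evident adjunction $\Lambda\dashv\Lambda$ has $\psi$ the identity equivalence and $\mathsf{nat}_{cod},\mathsf{nat}_{dom}$ given by $\mathsf{refl}$. -}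

{-# OPTIONS --without-K #-}
module Defs where

open import Level using (Level; Setω; _⊔_) renaming (suc to lsuc)
open import Data.Nat using (ℕ; zero; suc)
open import Data.Integer using (ℤ) renaming (_+_ to _+ℤ_)
open import Data.Product using (Σ; Σ-syntax; _,_; proj₁; proj₂)
open import Data.Unit using (⊤; tt)
open import Function.Properties.Inverse.HalfAdjointEquivalence using (_≃_)
open import Relation.Binary.PropositionalEquality using (_≡_; refl; sym; trans; cong; subst; dcong; cong-app; trans-assoc; trans-reflʳ)

-- Path concatenation p · q is  trans p q,  ap is  cong,  transport is  subst,
-- apd is  dcong  and happly is  cong-app.  `_≃_` is the library's type of
-- half adjoint equivalences; `IsEquiv f` is the corresponding structure on a
-- given map f.

record IsEquiv {a b} {A : Set a} {B : Set b} (f : A → B) : Set (a ⊔ b) where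
  field
    from             : B → A
    left-inverse-of  : ∀ x → from (f x) ≡ x
    right-inverse-of : ∀ y → f (from y) ≡ y
    left-right       : ∀ x → cong f (left-inverse-of x) ≡ right-inverse-of (f x)

idEquiv : ∀ {a} (A : Set a) → A ≃ A
idEquiv A = record
  { to               = λ x → x
  ; from             = λ x → x
  ; left-inverse-of  = λ _ → refl
  ; right-inverse-of = λ _ → refl
  ; left-right       = λ _ → refl
  }

idToEquiv : ∀ {a} {A B : Set a} → A ≡ B → A ≃ B
idToEquiv {A = A} refl = idEquiv A

IsContr : ∀ {a} → Set a → Set a
IsContr A = Σ[ x ∈ A ] (∀ y → x ≡ y)

-- Truncation levels start at -2, hence the shift of the index by two.

is-⟨_-2⟩-type : ∀ {a} → ℕ → Set a → Set a
is-⟨ zero  -2⟩-type A = IsContr A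
is-⟨ suc n -2⟩-type A = ∀ (x y : A) → is-⟨ n -2⟩-type (x ≡ y)

-- What Book HoTT adds to intensional type theory, restricted to what is used
-- here.  The computation rules of the higher inductive types are only required
-- up to a path, also on points.

record BookHoTT : Setω where
  field
    funext : ∀ {a b} {A : Set a} {B : A → Set b} {f g : ∀ x → B x} →
             IsEquiv (cong-app {f = f} {g = g})

    univalence : ∀ {a} {A B : Set a} → IsEquiv (idToEquiv {A = A} {B = B})

    S¹   : Set
    base : S¹
    loop : base ≡ base

    S¹-ind : ∀ {p} (P : S¹ → Set p) (b : P base) (l : subst P loop b ≡ b) →
             ∀ x → P x
    S¹-ind-base : ∀ {p} (P : S¹ → Set p) (b : P base) (l : subst P loop b ≡ b) →
                  S¹-ind P b l base ≡ b
    S¹-ind-loop : ∀ {p} (P : S¹ → Set p) (b : P base) (l : subst P loop b ≡ b) →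
                  dcong (S¹-ind P b l) loop ≡
                  trans (trans (cong (subst P loop) (S¹-ind-base P b l)) l)
                        (sym (S¹-ind-base P b l))

    ∥_∥⟨_-2⟩   : ∀ {a} → Set a → ℕ → Set a
    ∣_∣        : ∀ {a} {A : Set a} {n} → A → ∥ A ∥⟨ n -2⟩
    ∥∥-is-type : ∀ {a} {A : Set a} {n} → is-⟨ n -2⟩-type (∥ A ∥⟨ n -2⟩)
    ∥∥-ind     : ∀ {a p} {A : Set a} {n} (P : ∥ A ∥⟨ n -2⟩ → Set p) →
                 (∀ x → is-⟨ n -2⟩-type (P x)) → (∀ x → P ∣ x ∣) → ∀ x → P x
    ∥∥-ind-∣∣  : ∀ {a p} {A : Set a} {n} (P : ∥ A ∥⟨ n -2⟩ → Set p)
                 (t : ∀ x → is-⟨ n -2⟩-type (P x)) (f : ∀ x → P ∣ x ∣) (x : A) →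
                 ∥∥-ind P t f ∣ x ∣ ≡ f x

Set∙ : ∀ a → Set (lsuc a)
Set∙ a = Σ[ A ∈ Set a ] A

Ω : ∀ {a} → Set∙ a → Set∙ a
Ω (A , a) = (a ≡ a) , refl

record _→∙_ {a b} (X : Set∙ a) (Y : Set∙ b) : Set (a ⊔ b) where
  field
    map  : proj₁ X → proj₁ Y
    map∙ : map (proj₂ X) ≡ proj₂ Y

record _≃∙_ {a b} (X : Set∙ a) (Y : Set∙ b) : Set (a ⊔ b) where
  field
    equiv : proj₁ X ≃ proj₁ Y
    to∙   : _≃_.to equiv (proj₂ X) ≡ proj₂ Y

Ω-map : ∀ {a b} {X : Set∙ a} {Y : Set∙ b} → X →∙ Y → proj₁ (Ω X) → proj₁ (Ω Y)
Ω-map f p = trans (trans (sym map∙) (cong map p)) map∙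
  where open _→∙_ f

S¹∙ : BookHoTT → Set∙ Level.zero
S¹∙ H = BookHoTT.S¹ H , BookHoTT.base H

-- K(ℤ,2) is any pointed 1-connected 2-type K with π₂(K) ≅ ℤ as groups.  As K
-- is a 2-type, Ω²K is already a set, so π₂(K) is Ω²K.

record IsK[ℤ,2] (H : BookHoTT) {κ} (K : Set∙ κ) : Set κ where
  open BookHoTT H
  field
    1-connected : IsContr (∥ proj₁ K ∥⟨ 3 -2⟩)
    2-truncated : is-⟨ 4 -2⟩-type (proj₁ K)
    π₂≃ℤ        : proj₁ (Ω (Ω K)) ≃ ℤ
    π₂-hom      : ∀ p q → _≃_.to π₂≃ℤ (trans p q) ≡
                          _≃_.to π₂≃ℤ p +ℤ _≃_.to π₂≃ℤ q

record WildCategory (o h : Level) : Set (lsuc (o ⊔ h)) where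
  infixr 9 _∘_
  field
    Ob    : Set o
    Hom   : Ob → Ob → Set h
    id    : ∀ X → Hom X X
    _∘_   : ∀ {X Y Z} → Hom Y Z → Hom X Y → Hom X Z
    idˡ   : ∀ {X Y} (f : Hom X Y) → id Y ∘ f ≡ f
    idʳ   : ∀ {X Y} (f : Hom X Y) → f ∘ id X ≡ f
    assoc : ∀ {W X Y Z} (f : Hom Y Z) (g : Hom X Y) (h : Hom W X) →
            (f ∘ g) ∘ h ≡ f ∘ (g ∘ h)

record WildFunctor {o h o′ h′} (𝒞 : WildCategory o h) (𝒟 : WildCategory o′ h′) :
       Set (o ⊔ h ⊔ o′ ⊔ h′) where
  private
    module 𝒞 = WildCategory 𝒞
    module 𝒟 = WildCategory 𝒟
  field
    F₀   : 𝒞.Ob → 𝒟.Ob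
    F₁   : ∀ {X Y} → 𝒞.Hom X Y → 𝒟.Hom (F₀ X) (F₀ Y)
    F-∘  : ∀ {X Y Z} (g : 𝒞.Hom Y Z) (f : 𝒞.Hom X Y) →
           F₁ g 𝒟.∘ F₁ f ≡ F₁ (g 𝒞.∘ f)
    F-id : ∀ X → 𝒟.id (F₀ X) ≡ F₁ (𝒞.id X)

record _⊣_ {o h o′ h′} {𝒞 : WildCategory o h} {𝒟 : WildCategory o′ h′}
           (L : WildFunctor 𝒞 𝒟) (R : WildFunctor 𝒟 𝒞) :
           Set (o ⊔ h ⊔ o′ ⊔ h′) where
  private
    module 𝒞 = WildCategory 𝒞
    module 𝒟 = WildCategory 𝒟
    module L = WildFunctor L
    module R = WildFunctor R
  field
    ψ≃ : ∀ {A X} → 𝒟.Hom (L.F₀ A) X ≃ 𝒞.Hom A (R.F₀ X)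

  ψ : ∀ {A X} → 𝒟.Hom (L.F₀ A) X → 𝒞.Hom A (R.F₀ X)
  ψ = _≃_.to ψ≃

  field
    nat-cod : ∀ {A X Y} (g : 𝒟.Hom X Y) (h : 𝒟.Hom (L.F₀ A) X) →
              R.F₁ g 𝒞.∘ ψ h ≡ ψ (g 𝒟.∘ h)
    nat-dom : ∀ {A B X} (f : 𝒞.Hom A B) (h : 𝒟.Hom (L.F₀ B) X) →
              ψ h 𝒞.∘ f ≡ ψ (h 𝒟.∘ L.F₁ f)

Is2Coherent : ∀ {o h o′ h′} {𝒞 : WildCategory o h} {𝒟 : WildCategory o′ h′}
              {L : WildFunctor 𝒞 𝒟} {R : WildFunctor 𝒟 𝒞} →
              L ⊣ R → Set (o ⊔ h ⊔ o′ ⊔ h′)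
Is2Coherent {𝒞 = 𝒞} {𝒟 = 𝒟} {L = L} adj =
  ∀ {W Z X Y} (h₁ : 𝒟.Hom (L.F₀ X) Y) (h₂ : 𝒞.Hom Z X) (h₃ : 𝒞.Hom W Z) →
  trans (trans (𝒞.assoc (ψ h₁) h₂ h₃)
               (nat-dom (h₂ 𝒞.∘ h₃) h₁))
        (sym (cong ψ (cong (h₁ 𝒟.∘_) (L.F-∘ h₂ h₃))))
  ≡
  trans (trans (cong (𝒞._∘ h₃) (nat-dom h₂ h₁))
               (nat-dom h₃ (h₁ 𝒟.∘ L.F₁ h₂)))
        (cong ψ (𝒟.assoc h₁ (L.F₁ h₂) (L.F₁ h₃)))
  where
    module 𝒞 = WildCategory 𝒞
    module 𝒟 = WildCategory 𝒟
    module L = WildFunctor L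
    open _⊣_ adj

record Graph (γ₀ γ₁ : Level) : Set (lsuc (γ₀ ⊔ γ₁)) where
  field
    Γ₀ : Set γ₀
    Γ₁ : Γ₀ → Γ₀ → Set γ₁

module _ {γ₀ γ₁} (Γ : Graph γ₀ γ₁) where
  open Graph Γ

  record Diagram {o h} (𝒞 : WildCategory o h) : Set (γ₀ ⊔ γ₁ ⊔ o ⊔ h) where
    open WildCategory 𝒞
    field
      obj : Γ₀ → Ob
      arr : ∀ {i j} → Γ₁ i j → Hom (obj i) (obj j)

module _ {γ₀ γ₁} {Γ : Graph γ₀ γ₁} {o h} {𝒞 : WildCategory o h} where
  open Graph Γ
  open WildCategory 𝒞

  CoconeOn : Diagram Γ 𝒞 → Ob → Set (γ₀ ⊔ γ₁ ⊔ h)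
  CoconeOn F X = Σ[ s ∈ (∀ i → Hom (obj i) X) ]
                 (∀ i j (g : Γ₁ i j) → s j ∘ arr g ≡ s i)
    where open Diagram F

  record Cocone (F : Diagram Γ 𝒞) : Set (γ₀ ⊔ γ₁ ⊔ o ⊔ h) where
    open Diagram F
    field
      tip : Ob
      leg : ∀ i → Hom (obj i) tip
      com : ∀ i j (g : Γ₁ i j) → leg j ∘ arr g ≡ leg i

  postcomp : {F : Diagram Γ 𝒞} (𝒦 : Cocone F) (X : Ob) →
             Hom (Cocone.tip 𝒦) X → CoconeOn F X
  postcomp {F} 𝒦 X f =
      (λ i → f ∘ leg i)
    , (λ i j g → trans (assoc f (leg j) (arr g)) (cong (f ∘_) (com i j g)))
    where
      open Diagram F
      open Cocone 𝒦

  IsColimiting : {F : Diagram Γ 𝒞} → Cocone F → Set (γ₀ ⊔ γ₁ ⊔ o ⊔ h)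
  IsColimiting 𝒦 = ∀ X → IsEquiv (postcomp 𝒦 X)

module _ {o h o′ h′} {𝒞 : WildCategory o h} {𝒟 : WildCategory o′ h′}
         (L : WildFunctor 𝒞 𝒟) where
  open WildFunctor L

  mapDiagram : ∀ {γ₀ γ₁} {Γ : Graph γ₀ γ₁} → Diagram Γ 𝒞 → Diagram Γ 𝒟
  mapDiagram F = record
    { obj = λ i → F₀ (obj i)
    ; arr = λ g → F₁ (arr g)
    }
    where open Diagram F

  mapCocone : ∀ {γ₀ γ₁} {Γ : Graph γ₀ γ₁} {F : Diagram Γ 𝒞} →
              Cocone F → Cocone (mapDiagram F)
  mapCocone {F = F} 𝒦 = record
    { tip = F₀ tip
    ; leg = λ i → F₁ (leg i)
    ; com = λ i j g → trans (F-∘ (leg j) (arr g)) (cong F₁ (com i j g))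
    }
    where
      open Diagram F
      open Cocone 𝒦

  PreservesColimits : ∀ γ₀ γ₁ → Set (lsuc (γ₀ ⊔ γ₁) ⊔ o ⊔ h ⊔ o′ ⊔ h′)
  PreservesColimits γ₀ γ₁ =
    (Γ : Graph γ₀ γ₁) (F : Diagram Γ 𝒞) (𝒦 : Cocone F) →
    IsColimiting 𝒦 → IsColimiting (mapCocone 𝒦)

module _ (H : BookHoTT) {κ} (K : Set∙ κ) (e : S¹∙ H ≃∙ Ω K) where
  open BookHoTT H
  open _≃∙_ e
  open _≃_ equiv

  infixl 7 _•_
  _•_ : S¹ → S¹ → S¹
  x • y = from (trans (to x) (to y))

  •-unitˡ : ∀ x → base • x ≡ x
  •-unitˡ x = trans (cong (λ p → from (trans p (to x))) to∙)
                    (left-inverse-of x)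

  •-unitʳ : ∀ x → x • base ≡ x
  •-unitʳ x = trans (cong (λ p → from (trans (to x) p)) to∙)
             (trans (cong from (trans-reflʳ (to x)))
                    (left-inverse-of x))

  •-assoc : ∀ x y z → (x • y) • z ≡ x • (y • z)
  •-assoc x y z =
    trans (cong (λ p → from (trans p (to z))) (right-inverse-of (trans (to x) (to y))))
    (trans (cong from (trans-assoc (to x)))
           (cong (λ p → from (trans (to x) p)) (sym (right-inverse-of (trans (to y) (to z))))))

  𝓔 : WildCategory Level.zero Level.zero
  𝓔 = record
    { Ob    = ⊤
    ; Hom   = λ _ _ → S¹
    ; id    = λ _ → base
    ; _∘_   = λ g f → f • g
    ; idˡ   = •-unitʳ
    ; idʳ   = •-unitˡ
    ; assoc = λ f g h → sym (•-assoc h g f)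
    }

  right-mul : (ℓ : S¹) → (S¹ , base) →∙ (S¹ , ℓ)
  right-mul ℓ = record { map = _• ℓ ; map∙ = •-unitˡ ℓ }

  loop-at : (ℓ : S¹) → ℓ ≡ ℓ
  loop-at ℓ = Ω-map (right-mul ℓ) loop

  Λ : WildFunctor 𝓔 𝓔
  Λ = record
    { F₀   = λ X → X
    ; F₁   = λ f → f
    ; F-∘  = λ g f → loop-at (f • g)
    ; F-id = λ _ → refl
    }

  Λ⊣Λ : Λ ⊣ Λ
  Λ⊣Λ = record
    { ψ≃      = idEquiv S¹
    ; nat-cod = λ _ _ → refl
    ; nat-dom = λ _ _ → refl
    }

{-# OPTIONS --safe #-}
{-# OPTIONS --without-K #-}
-- For h₁ = h₂ = h₃ = base, 2-coherence would make a conjugate of loop trivial.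
-- The circle would then be contractible, and so would Ω²K ≃ ℤ.
--
-- The loops L ℓ : ℓ ≡ ℓ form a homotopy from the identity of S¹ to itself, and
-- right multiplication by f carries L ℓ to L (ℓ • f): as S¹ is a connected
-- 1-type, it suffices to see this for f = base.  Therefore the postcomposition
-- map of Λ 𝒦 is that of 𝒦 followed by the automorphism (s , σ) ↦ (s , L · σ)
-- of the type of cocones.
module Submission where

open import Defs
open import Level using (Level)
open import Data.Integer using (ℤ; 0ℤ; 1ℤ)
open import Data.Nat using (zero; suc)
open import Data.Product using (_×_; _,_; proj₁; proj₂)
open import Function.Bundles using (_↔_; mk↔ₛ′; module Inverse)
open import Function.Properties.Inverse.HalfAdjointEquivalence using (_≃_; ↔⇒≃)
open import Relation.Binary.PropositionalEquality
  using (_≡_; refl; sym; trans; cong; subst; naturality; cong-id; trans-cong; trans-assoc;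
         trans-reflʳ; trans-symˡ; trans-injectiveˡ; module ≡-Reasoning)
open import Relation.Nullary using (¬_)

private
  variable
    a b : Level
    A : Set a
    B : Set b

trans-cancelʳ-refl : {x y : A} (p : x ≡ y) {q : y ≡ y} → trans p q ≡ p → q ≡ refl
trans-cancelʳ-refl refl eq = eq

conj-refl⇒refl : {x y : A} (p : x ≡ y) {q : x ≡ x} →
                 trans (trans (sym p) q) p ≡ refl → q ≡ refl
conj-refl⇒refl refl eq = trans (sym (trans-reflʳ _)) eq

trans-sym-cancel : {x y z : A} (p : x ≡ y) (q : x ≡ z) → trans p (trans (sym p) q) ≡ q
trans-sym-cancel refl q = refl

sym-trans-cancel : {x y z : A} (p : y ≡ x) (q : x ≡ z) → trans (sym p) (trans p q) ≡ q
sym-trans-cancel refl q = refl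

module _ {f : A → A} (f~id : ∀ x → f x ≡ x) where

  naturality-id : {x y : A} (p : x ≡ y) → trans (cong f p) (f~id y) ≡ trans (f~id x) p
  naturality-id p = trans (naturality f~id) (cong (trans (f~id _)) (cong-id p))

  -- By naturality, `cong f p` is the conjugate of `p` by `f~id x`.
  cong-refl⇒refl : {x : A} {p : x ≡ x} → cong f p ≡ refl → p ≡ refl
  cong-refl⇒refl {x} {p} eq = trans-cancelʳ-refl (f~id x)
    (trans (sym (naturality-id p)) (cong (λ q → trans q (f~id x)) eq))

self-homotopy-natural : (L : (x : A) → x ≡ x) {x y : A} (p : x ≡ y) →
                        trans (L x) p ≡ trans p (L y)
self-homotopy-natural L refl = trans-reflʳ _

-- Both sides agree after composition with `f~id x`: one by naturality of `f~id` along `L x`, the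
-- other by naturality of `L` along `f~id x`.
cong-self-homotopy : {f : A → A} → (∀ x → f x ≡ x) → (L : (x : A) → x ≡ x) →
                     ∀ x → cong f (L x) ≡ L (f x)
cong-self-homotopy f~id L x = trans-injectiveˡ (f~id x)
  (trans (naturality-id f~id (L x)) (sym (self-homotopy-natural L (f~id x))))

-- Induction on the level: each path type of a retract is a retract of a path type, via `cong r`
-- corrected by `rs` at both ends.
retract-is-type : ∀ n {A : Set a} {B : Set b} (r : B → A) (s : A → B) →
                  (∀ x → r (s x) ≡ x) → is-⟨ n -2⟩-type B → is-⟨ n -2⟩-type A
retract-is-type zero r s rs (c , contr) = r c , λ x → trans (cong r (contr (s x))) (rs x)
retract-is-type (suc n) {A = A} r s rs t x y =
  retract-is-type n (λ q → trans (sym (rs x)) (trans (cong r q) (rs y))) (cong s) retraction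
    (t (s x) (s y))
  where
  retraction : ∀ {y} (p : x ≡ y) →
               trans (sym (rs x)) (trans (cong r (cong s p)) (rs y)) ≡ p
  retraction refl = trans-symˡ (rs x)

contr⇒prop : IsContr A → is-⟨ 1 -2⟩-type A
contr⇒prop (_ , contr) x y =
  trans (sym (contr x)) (contr y) , λ { refl → trans-symˡ (contr x) }

contr-ℤ-impossible : ¬ IsContr ℤ
contr-ℤ-impossible (_ , contr) with () ← trans (sym (contr 0ℤ)) (contr 1ℤ)

equiv-∘ : ∀ {c} {C : Set c} {f : A → B} → IsEquiv f → (φ : B ↔ C) → {g : A → C} →
          (∀ x → Inverse.to φ (f x) ≡ g x) → IsEquiv g
equiv-∘ {f = f} f-equiv φ {g} φf~g = record
  { from             = _≃_.from g≃
  ; left-inverse-of  = _≃_.left-inverse-of g≃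
  ; right-inverse-of = _≃_.right-inverse-of g≃
  ; left-right       = _≃_.left-right g≃
  }
  where
  module f = IsEquiv f-equiv
  module φ = Inverse φ
  g≃ = ↔⇒≃ (mk↔ₛ′ g (λ z → f.from (φ.from z))
    (λ z → trans (sym (φf~g _))
             (trans (cong φ.to (f.right-inverse-of (φ.from z))) (φ.strictlyInverseˡ z)))
    (λ x → trans (cong (λ z → f.from (φ.from z)) (sym (φf~g x)))
             (trans (cong f.from (φ.strictlyInverseʳ (f x))) (f.left-inverse-of x))))

module _ (H : BookHoTT) where
  open BookHoTT H

  funExt : {B : A → Set b} {f g : (x : A) → B x} → (∀ x → f x ≡ g x) → f ≡ g
  funExt = IsEquiv.from funext

  S¹-prop-ind : (P : S¹ → Set a) → (∀ x (p q : P x) → p ≡ q) → P base → ∀ x → P x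
  S¹-prop-ind P P-prop b = S¹-ind P b (P-prop base _ b)

  trivial-loop⇒S¹-contr : loop ≡ refl → IsContr S¹
  trivial-loop⇒S¹-contr loop≡refl =
    -- Transporting `refl` along `refl` computes to `refl`, so the hypothesis on `loop` settles the
    -- loop case.
    base , S¹-ind (base ≡_) refl (cong (λ p → subst (base ≡_) p refl) loop≡refl)

  module _ {κ} (K : Set∙ κ) (isK : IsK[ℤ,2] H K) (e : S¹∙ H ≃∙ Ω K) where
    open IsK[ℤ,2] isK
    open _≃_ (_≃∙_.equiv e) using (to; from; left-inverse-of; right-inverse-of)
    module π₂ = _≃_ π₂≃ℤ

    infixl 7 _∙_
    _∙_ : S¹ → S¹ → S¹
    _∙_ = _•_ H K e

    L : (ℓ : S¹) → ℓ ≡ ℓ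
    L = loop-at H K e

    S¹-1-type : is-⟨ 3 -2⟩-type S¹
    S¹-1-type = retract-is-type 3 from to left-inverse-of (2-truncated (proj₂ K) (proj₂ K))

    loop-nontrivial : ¬ (loop ≡ refl)
    loop-nontrivial loop≡refl = contr-ℤ-impossible
      -- A contractible circle is a proposition, hence so is its retract `Ω K`; its path type at
      -- `refl , refl` is then contractible and retracts onto `ℤ`.
      (retract-is-type 0 π₂.to π₂.from π₂.right-inverse-of
        (retract-is-type 1 to from right-inverse-of
          (contr⇒prop (trivial-loop⇒S¹-contr loop≡refl)) refl refl))

    loop-at-base-nontrivial : ¬ (L base ≡ refl)
    loop-at-base-nontrivial eq = loop-nontrivial
      (cong-refl⇒refl (•-unitʳ H K e) (conj-refl⇒refl (•-unitˡ H K e base) eq))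

    Λ-not-2-coherent : ¬ Is2Coherent (Λ⊣Λ H K e)
    Λ-not-2-coherent coh = loop-at-base-nontrivial
      -- Here `cancel` yields that `cong (_∙ base) (L (base ∙ base))` is trivial; right
      -- multiplication by `base` is homotopic to the identity, and `base ∙ base` is `base`.
      (subst (λ ℓ → L ℓ ≡ refl) (•-unitʳ H K e base)
        (cong-refl⇒refl (•-unitʳ H K e)
          (cancel (sym (•-assoc H K e base base base)) (coh base base base))))
      where
      -- As `ψ` is the identity and `nat-dom` is `refl`, coherence reduces to the same associator
      -- `α` on both sides, with the compositor term `q` on one side only.
      cancel : {A : Set} {x y : A} (α : x ≡ y) {q : y ≡ y} →
               trans (trans α refl) (sym (cong (λ z → z) q)) ≡ cong (λ z → z) α → q ≡ refl
      cancel refl {q} eq = begin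
        q                             ≡⟨ cong-id q ⟨
        cong (λ z → z) q              ≡⟨ sym-involutive _ ⟨
        sym (sym (cong (λ z → z) q))  ≡⟨ cong sym eq ⟩
        refl                          ∎
        where
        open ≡-Reasoning
        sym-involutive : ∀ {x y} (p : x ≡ y) → sym (sym p) ≡ p
        sym-involutive refl = refl

    right-mul-loop-at : ∀ ℓ f → cong (_∙ f) (L ℓ) ≡ L (ℓ ∙ f)
    right-mul-loop-at ℓ = S¹-prop-ind (λ f → cong (_∙ f) (L ℓ) ≡ L (ℓ ∙ f))
      (λ f p q → proj₁ (S¹-1-type _ _ _ _ p q))
      (cong-self-homotopy (•-unitʳ H K e) L ℓ)

    module _ {γ₀ γ₁} {Γ : Graph γ₀ γ₁} (F : Diagram Γ (𝓔 H K e)) where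
      open Diagram F

      -- Since `Λ` is the identity on objects and morphisms, cocones under `F` and under its image
      -- form the same type. The legs stay fixed, so inverses are checked on the commuting paths
      -- alone.
      twist : ∀ X → CoconeOn F X ↔ CoconeOn F X
      twist X = mk↔ₛ′
        (λ (s , σ) → s , λ i j g → trans (L (arr g ∙ s j)) (σ i j g))
        (λ (s , σ) → s , λ i j g → trans (sym (L (arr g ∙ s j))) (σ i j g))
        (λ (s , σ) → cong (s ,_) (funExt λ i → funExt λ j → funExt λ g →
          trans-sym-cancel (L (arr g ∙ s j)) (σ i j g)))
        (λ (s , σ) → cong (s ,_) (funExt λ i → funExt λ j → funExt λ g →
          sym-trans-cancel (L (arr g ∙ s j)) (σ i j g)))

      twist-postcomp : (𝒦 : Cocone F) → ∀ X f → Inverse.to (twist X) (postcomp 𝒦 X f) ≡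
                       postcomp (mapCocone (Λ H K e) 𝒦) X f
      twist-postcomp 𝒦 X f = cong ((λ i → leg i ∙ f) ,_)
        (funExt λ i → funExt λ j → funExt λ g → twist-com (arr g) (leg j) (com i j g))
        where
        open Cocone 𝒦
        open ≡-Reasoning
        -- `L` slides past the associator because it is natural, and then enters `cong (_∙ f)` by
        -- `right-mul-loop-at`.
        twist-com : ∀ a l {m} (c : a ∙ l ≡ m) →
          trans (L (a ∙ (l ∙ f))) (trans (sym (•-assoc H K e a l f)) (cong (_∙ f) c)) ≡
          trans (sym (•-assoc H K e a l f)) (cong (_∙ f) (trans (L (a ∙ l)) (cong (λ x → x) c)))
        twist-com a l c = begin
          trans (L (a ∙ (l ∙ f))) (trans α (cong (_∙ f) c))
            ≡⟨ trans-assoc (L (a ∙ (l ∙ f))) ⟨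
          trans (trans (L (a ∙ (l ∙ f))) α) (cong (_∙ f) c)
            ≡⟨ cong (λ p → trans p (cong (_∙ f) c)) (self-homotopy-natural L α) ⟩
          trans (trans α (L ((a ∙ l) ∙ f))) (cong (_∙ f) c)
            ≡⟨ trans-assoc α ⟩
          trans α (trans (L ((a ∙ l) ∙ f)) (cong (_∙ f) c))
            ≡⟨ cong (λ p → trans α (trans p (cong (_∙ f) c))) (right-mul-loop-at (a ∙ l) f) ⟨
          trans α (trans (cong (_∙ f) (L (a ∙ l))) (cong (_∙ f) c))
            ≡⟨ cong (trans α) (trans-cong (L (a ∙ l))) ⟩
          trans α (cong (_∙ f) (trans (L (a ∙ l)) c))
            ≡⟨ cong (λ p → trans α (cong (_∙ f) (trans (L (a ∙ l)) p))) (cong-id c) ⟨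
          trans α (cong (_∙ f) (trans (L (a ∙ l)) (cong (λ x → x) c))) ∎
          where α = sym (•-assoc H K e a l f)

    Λ-preserves-colimits : ∀ {γ₀ γ₁} → PreservesColimits (Λ H K e) γ₀ γ₁
    Λ-preserves-colimits Γ F 𝒦 colim X = equiv-∘ (colim X) (twist F X) (twist-postcomp F 𝒦 X)

mainTheorem4 : (H : BookHoTT) {κ : Level} (K : Set∙ κ) → IsK[ℤ,2] H K →
    (e : S¹∙ H ≃∙ Ω K) →
    ∀ {γ₀ γ₁ : Level} →
    (¬ Is2Coherent (Λ⊣Λ H K e)) × PreservesColimits (Λ H K e) γ₀ γ₁
mainTheorem4 H K isK e = Λ-not-2-coherent H K isK e , Λ-preserves-colimits H K isK e
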